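{- Let $D=\{f(a,a): a\ge 0\}$ and $S=\{p\ge 1: \text{there exists an integer } r \text{ with } 0\le r<p \text{ such that } f(p,r)=p\}$. Then every positive integer belongs to exactly one of $D$ and $S$.
   Context: Three-row Chomp. A position is a triple $[p,q,r]$ of integers with $p\ge q\ge r\ge 0$ (row lengths). The moves from $[p,q,r]$ are: reduce the first row to length $a$ with $0\le a<p$, giving $[a,\min(a,q),\min(a,r)]$; reduce the second row to length $a$ with $0\le a<q$, giving $[p,a,\min(a,r)]$; reduce the third row to length $b$ with $0\le b<r$, giving $[p,q,b]$. The player who moves to $[0,0,0]$ loses. A $P$-position is a position from which the previous player wins, and an $N$-position is one from which the next player wins. Equivalently: $[0,0,0]$ is an $N$-position, and a position other than $[0,0,0]$ is a $P$-position if and only if no move from it leads to a $P$-position. The function $f$. For all integers $q\ge r\ge 0$ there is a unique integer $p>r$ such that either (i) $r<p<q$ and $[p,p,r]$ is a $P$-position, or (ii) $p\ge q$ and $[p,q,r]$ is a $P$-position. This integer is denoted $f(q,r)$. -}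

module Defs where

open import Data.Nat using (ℕ; zero; suc; _+_; _⊓_; _≤_; _<_; z≤n; s≤s; s≤s⁻¹; _≤?_; _<?_)
open import Data.Nat.Properties
open import Data.Nat.Induction using (<-wellFounded)
open import Data.Fin as Fin using (Fin; toℕ; fromℕ<; _↑ˡ_; _↑ʳ_)
open import Data.Fin.Properties as Finₚ using (pigeonhole; splitAt-↑ˡ; splitAt-↑ʳ; toℕ-fromℕ<)
open import Data.Product using (Σ-syntax; ∃-syntax; _×_; _,_; proj₁; proj₂)
open import Data.Sum using (_⊎_; inj₁; inj₂)
open import Data.Empty using (⊥; ⊥-elim)
open import Induction.WellFounded using (Acc; acc)
open import Relation.Nullary using (¬_; Dec; yes; no; recompute)
open import Relation.Nullary.Decidable using (map′)
open import Relation.Unary using (Pred)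
open import Relation.Binary.Definitions using (tri<; tri≈; tri>)
open import Relation.Binary.PropositionalEquality using (_≡_; _≢_; refl; sym; trans; cong; subst)
open import Level using (0ℓ)

-- The inequalities are irrelevant, so positions are determined by their rows.
record Position : Set where
  constructor pos
  field
    row₁ row₂ row₃ : ℕ
    .row₂≤row₁ : row₂ ≤ row₁
    .row₃≤row₂ : row₃ ≤ row₂

open Position

origin : Position
origin = pos 0 0 0 z≤n z≤n

infix 4 _⟶_

data _⟶_ : Position → Position → Set where
  cut₁ : ∀ {p q r} .{q≤p : q ≤ p} .{r≤q : r ≤ q} a (a<p : a < p) →
         pos p q r q≤p r≤q ⟶ pos a (a ⊓ q) (a ⊓ r) (m⊓n≤m a q) (⊓-monoʳ-≤ a r≤q)
  cut₂ : ∀ {p q r} .{q≤p : q ≤ p} .{r≤q : r ≤ q} a (a<q : a < q) →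
         pos p q r q≤p r≤q ⟶ pos p a (a ⊓ r) (≤-trans (<⇒≤ a<q) q≤p) (m⊓n≤m a r)
  cut₃ : ∀ {p q r} .{q≤p : q ≤ p} .{r≤q : r ≤ q} b (b<r : b < r) →
         pos p q r q≤p r≤q ⟶ pos p q b q≤p (≤-trans (<⇒≤ b<r) r≤q)

-- The player who moves to the origin loses, so the origin is a win for the
-- player about to move, although that player has no move.
data IsP : Position → Set
data IsN : Position → Set

data IsP where
  allN : ∀ {x} → x ≢ origin → (∀ {y} → x ⟶ y → IsN y) → IsP x

data IsN where
  atOrigin : IsN origin
  someP    : ∀ {x y} → x ⟶ y → IsP y → IsN x

P∧N⇒⊥ : ∀ {x} → IsP x → IsN x → ⊥
P∧N⇒⊥ (allN x≢o _) atOrigin    = x≢o refl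
P∧N⇒⊥ (allN _ h)   (someP m p) = P∧N⇒⊥ p (h m)

P⟶P⇒⊥ : ∀ {x y} → IsP x → x ⟶ y → IsP y → ⊥
P⟶P⇒⊥ px m py = P∧N⇒⊥ px (someP m py)

size : Position → ℕ
size x = row₁ x + (row₂ x + row₃ x)

⟶-size : ∀ {x y} → x ⟶ y → size y < size x
⟶-size (cut₁ {p} {q} {r} a a<p) = +-mono-<-≤ a<p (+-mono-≤ (m⊓n≤n a q) (m⊓n≤n a r))
⟶-size (cut₂ {p} {q} {r} a a<q) = +-monoʳ-< p (+-mono-<-≤ a<q (m⊓n≤n a r))
⟶-size (cut₃ {p} {q} {r} b b<r) = +-monoʳ-< p (+-monoʳ-< q b<r)

search : ∀ n (A B : ∀ a → .(a < n) → Set) →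
         (∀ a (a<n : a < n) → A a a<n ⊎ B a a<n) →
         (Σ[ a ∈ ℕ ] Σ[ a<n ∈ a < n ] A a a<n) ⊎ (∀ a (a<n : a < n) → B a a<n)
search zero    A B h = inj₂ λ _ ()
search (suc n) A B h
  with search n (λ a a<n → A a (m<n⇒m<1+n a<n)) (λ a a<n → B a (m<n⇒m<1+n a<n))
              (λ a a<n → h a (m<n⇒m<1+n a<n))
     | h n (n<1+n n)
... | inj₁ (a , a<n , x) | _      = inj₁ (a , m<n⇒m<1+n a<n , x)
... | inj₂ _             | inj₁ x = inj₁ (n , n<1+n n , x)
... | inj₂ g             | inj₂ y = inj₂ all
  where
  all : ∀ a (a<1+n : a < suc n) → B a a<1+n
  all a a<1+n with m≤n⇒m<n∨m≡n (s≤s⁻¹ a<1+n)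
  ... | inj₁ a<n  = g a a<n
  ... | inj₂ refl = y

isOrigin? : ∀ x → Dec (x ≡ origin)
isOrigin? (pos (suc _) _ _ _ _)         = no λ ()
isOrigin? (pos zero (suc _) _ _ _)      = no λ ()
isOrigin? (pos zero zero (suc _) _ _)   = no λ ()
isOrigin? (pos zero zero zero _ _)      = yes refl

P⊎N′ : ∀ x → Acc _<_ (size x) → IsP x ⊎ IsN x
P⊎N′ x (acc rs) with isOrigin? x
... | yes refl = inj₂ atOrigin
P⊎N′ (pos p q r q≤p r≤q) (acc rs) | no x≢o
  with search p (λ a a<p → IsP (pos a (a ⊓ q) (a ⊓ r) (m⊓n≤m a q) (⊓-monoʳ-≤ a r≤q)))
                (λ a a<p → IsN (pos a (a ⊓ q) (a ⊓ r) (m⊓n≤m a q) (⊓-monoʳ-≤ a r≤q)))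
                (λ a a<p → P⊎N′ _ (rs (⟶-size (cut₁ {q≤p = q≤p} {r≤q} a a<p))))
     | search q (λ a a<q → IsP (pos p a (a ⊓ r) (≤-trans (<⇒≤ a<q) q≤p) (m⊓n≤m a r)))
                (λ a a<q → IsN (pos p a (a ⊓ r) (≤-trans (<⇒≤ a<q) q≤p) (m⊓n≤m a r)))
                (λ a a<q → P⊎N′ _ (rs (⟶-size (cut₂ {q≤p = q≤p} {r≤q} a a<q))))
     | search r (λ b b<r → IsP (pos p q b q≤p (≤-trans (<⇒≤ b<r) r≤q)))
                (λ b b<r → IsN (pos p q b q≤p (≤-trans (<⇒≤ b<r) r≤q)))
                (λ b b<r → P⊎N′ _ (rs (⟶-size (cut₃ {q≤p = q≤p} {r≤q} b b<r))))
... | inj₁ (a , l , x) | _ | _ = inj₂ (someP (cut₁ a l) x)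
... | inj₂ _ | inj₁ (a , l , x) | _ = inj₂ (someP (cut₂ a l) x)
... | inj₂ _ | inj₂ _ | inj₁ (b , l , x) = inj₂ (someP (cut₃ b l) x)
... | inj₂ h₁ | inj₂ h₂ | inj₂ h₃ =
  inj₁ (allN x≢o λ { (cut₁ a l) → h₁ a l ; (cut₂ a l) → h₂ a l ; (cut₃ b l) → h₃ b l })

P⊎N : ∀ x → IsP x ⊎ IsN x
P⊎N x = P⊎N′ x (<-wellFounded (size x))

IsP? : ∀ x → Dec (IsP x)
IsP? x with P⊎N x
... | inj₁ p = yes p
... | inj₂ n = no λ p → P∧N⇒⊥ p n

-- p satisfies the property that characterizes f(q,r).
data IsF (q r : ℕ) .(r≤q : r ≤ q) (p : ℕ) : Set where
  below : (r<p : r < p) → p < q → IsP (pos p p r ≤-refl (<⇒≤ r<p)) → IsF q r r≤q p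
  above : r < p → (q≤p : q ≤ p) → IsP (pos p q r q≤p r≤q) → IsF q r r≤q p

IsF? : ∀ q r .(r≤q : r ≤ q) p → Dec (IsF q r r≤q p)
IsF? q r r≤q p with r <? p
... | no r≮p = no λ { (below r<p _ _) → r≮p r<p ; (above r<p _ _) → r≮p r<p }
... | yes r<p with q ≤? p
...   | yes q≤p = map′ (above r<p q≤p)
                       (λ { (below _ p<q _) → ⊥-elim (<⇒≱ p<q q≤p) ; (above _ _ x) → x })
                       (IsP? _)
...   | no q≰p  = map′ (below r<p (≰⇒> q≰p))
                       (λ { (below _ _ x) → x ; (above _ q≤p _) → ⊥-elim (q≰p q≤p) })
                       (IsP? _)

pos-cong : ∀ {p q q′ r r′} .{a : q ≤ p} .{b : r ≤ q} .{a′ : q′ ≤ p} .{b′ : r′ ≤ q′} →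
           q ≡ q′ → r ≡ r′ → pos p q r a b ≡ pos p q′ r′ a′ b′
pos-cong refl refl = refl

-- cut₁ and cut₂ with the minima evaluated.
cut₁-to : ∀ {p q r q′ r′} .{q≤p : q ≤ p} .{r≤q : r ≤ q} a .{h : q′ ≤ a} .{k : r′ ≤ q′} →
          a < p → a ⊓ q ≡ q′ → a ⊓ r ≡ r′ → pos p q r q≤p r≤q ⟶ pos a q′ r′ h k
cut₁-to a a<p refl refl = cut₁ a a<p

cut₂-to : ∀ {p q r r′} .{q≤p : q ≤ p} .{r≤q : r ≤ q} a .{h : a ≤ p} .{k : r′ ≤ a} →
          a < q → a ⊓ r ≡ r′ → pos p q r q≤p r≤q ⟶ pos p a r′ h k
cut₂-to a a<q refl = cut₂ a a<q

IsF-< : ∀ {q r p p′} .{r≤q : r ≤ q} → IsF q r r≤q p → IsF q r r≤q p′ → ¬ p < p′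
IsF-< (below r<p p<q x) (below _ _ y) p<p′ =
  P⟶P⇒⊥ y (cut₁-to _ p<p′ (m≤n⇒m⊓n≡m (<⇒≤ p<p′)) (m≥n⇒m⊓n≡n (<⇒≤ r<p))) x
IsF-< (below r<p p<q x) (above _ _ y) p<p′ =
  P⟶P⇒⊥ y (cut₁-to _ p<p′ (m≤n⇒m⊓n≡m (<⇒≤ p<q)) (m≥n⇒m⊓n≡n (<⇒≤ r<p))) x
IsF-< (above _ q≤p _) (below _ p′<q _) p<p′ = <⇒≱ (<-trans p<p′ p′<q) q≤p
IsF-< (above r<p q≤p x) (above _ _ y) p<p′ =
  P⟶P⇒⊥ y (cut₁-to _ p<p′ (m≥n⇒m⊓n≡n q≤p) (m≥n⇒m⊓n≡n (<⇒≤ r<p))) x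

IsF-unique : ∀ {q r p p′} .{r≤q : r ≤ q} → IsF q r r≤q p → IsF q r r≤q p′ → p ≡ p′
IsF-unique {p = p} {p′} x y with <-cmp p p′
... | tri< p<p′ _ _ = ⊥-elim (IsF-< x y p<p′)
... | tri≈ _ e _    = e
... | tri> _ _ p′<p = ⊥-elim (IsF-< y x p′<p)

-- Strategy stealing: anything reachable from [a,a,a-1] is reachable from [a,a,a].
¬P-equal : ∀ a .{h : a ≤ a} .{k : a ≤ a} → ¬ IsP (pos a a a h k)
¬P-equal zero    (allN x≢o _) = x≢o refl
¬P-equal (suc n) eq@(allN _ toN) with toN (cut₃ n (n<1+n n))
... | someP (cut₁ a a<1+n) x =
  P⟶P⇒⊥ eq (cut₁-to a a<1+n refl
    (trans (m≤n⇒m⊓n≡m (<⇒≤ a<1+n)) (sym (m≤n⇒m⊓n≡m (s≤s⁻¹ a<1+n))))) x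
... | someP (cut₂ a a<1+n) x =
  P⟶P⇒⊥ eq (cut₂-to a a<1+n
    (trans (m≤n⇒m⊓n≡m (<⇒≤ a<1+n)) (sym (m≤n⇒m⊓n≡m (s≤s⁻¹ a<1+n))))) x
... | someP (cut₃ b b<n) x = P⟶P⇒⊥ eq (cut₃ b (m<n⇒m<1+n b<n)) x

-- If no p is a value, every [p,q,r] with p > q has a P-option shortening row 2
-- or row 3; each of the q + r such shortenings serves at most one p.
module Existence (q r : ℕ) (r≤q : r ≤ q) where

  data Option (p : ℕ) .(q≤p : q ≤ p) : Fin (q + r) → Set where
    row2 : ∀ (i : Fin q) → IsP (pos p (toℕ i) (toℕ i ⊓ r)
             (≤-trans (<⇒≤ (Finₚ.toℕ<n i)) q≤p) (m⊓n≤m (toℕ i) r)) → Option p q≤p (i ↑ˡ r)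
    row3 : ∀ (i : Fin r) → IsP (pos p q (toℕ i) q≤p
             (≤-trans (<⇒≤ (Finₚ.toℕ<n i)) r≤q)) → Option p q≤p (q ↑ʳ i)

  lower₁ : ∀ {p p′ s t} .{a : s ≤ p} .{b : t ≤ s} .{a′ : s ≤ p′} .{b′ : t ≤ s} →
           s ≤ p → t ≤ p → p < p′ → IsP (pos p s t a b) → IsP (pos p′ s t a′ b′) → ⊥
  lower₁ s≤p t≤p p<p′ x y =
    P⟶P⇒⊥ y (cut₁-to _ p<p′ (m≥n⇒m⊓n≡n s≤p) (m≥n⇒m⊓n≡n t≤p)) x

  Option-< : ∀ {p p′} (q≤p : q ≤ p) .(q≤p′ : q ≤ p′) {k k′} → k ≡ k′ →
             Option p q≤p k → Option p′ q≤p′ k′ → ¬ p < p′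
  Option-< q≤p q≤p′ e (row2 i x) (row2 j y) p<p′ with Finₚ.↑ˡ-injective r i j e
  ... | refl = lower₁ (≤-trans (<⇒≤ (Finₚ.toℕ<n i)) q≤p)
                      (≤-trans (m⊓n≤n (toℕ i) r) (≤-trans r≤q q≤p)) p<p′ x y
  Option-< q≤p q≤p′ e (row3 i x) (row3 j y) p<p′ with Finₚ.↑ʳ-injective q i j e
  ... | refl = lower₁ q≤p (≤-trans (<⇒≤ (Finₚ.toℕ<n i)) (≤-trans r≤q q≤p)) p<p′ x y
  Option-< q≤p q≤p′ e (row2 i x) (row3 j y) _
    with trans (sym (splitAt-↑ˡ q i r)) (trans (cong (Fin.splitAt q) e) (splitAt-↑ʳ q r j))
  ... | ()
  Option-< q≤p q≤p′ e (row3 i x) (row2 j y) _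
    with trans (sym (splitAt-↑ʳ q r i)) (trans (cong (Fin.splitAt q) e) (splitAt-↑ˡ q j r))
  ... | ()

  value-or-option : ∀ p (q<p : q < p) →
                    (∃[ p′ ] IsF q r r≤q p′) ⊎ (∃[ k ] Option p (<⇒≤ q<p) k)
  value-or-option p q<p with P⊎N (pos p q r (<⇒≤ q<p) r≤q)
  ... | inj₁ x = inj₁ (p , above (≤-<-trans r≤q q<p) (<⇒≤ q<p) x)
  ... | inj₂ atOrigin = ⊥-elim (n≮0 q<p)
  ... | inj₂ (someP (cut₂ a a<q) x) = inj₂ (_ , row2 (fromℕ< a<q) (subst IsP-at (sym (toℕ-fromℕ< a<q)) (λ _ _ → x) _ _))
    where
    IsP-at : ℕ → Set
    IsP-at a = .(h : a ≤ p) .(k : a ⊓ r ≤ a) → IsP (pos p a (a ⊓ r) h k)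
  ... | inj₂ (someP (cut₃ b b<r) x) = inj₂ (_ , row3 (fromℕ< b<r) (subst IsP-at (sym (toℕ-fromℕ< b<r)) (λ _ → x) _))
    where
    IsP-at : ℕ → Set
    IsP-at b = .(k : b ≤ q) → IsP (pos p q b (<⇒≤ q<p) k)
  ... | inj₂ (someP (cut₁ a a<p) x) with a ≤? r
  ...   | yes a≤r = ⊥-elim (¬P-equal a {≤-refl} {≤-refl}
                      (subst IsP (pos-cong (m≤n⇒m⊓n≡m (≤-trans a≤r r≤q)) (m≤n⇒m⊓n≡m a≤r)) x))
  ...   | no a≰r with q ≤? a
  ...     | yes q≤a = inj₁ (a , above (≰⇒> a≰r) q≤a
                        (subst IsP (pos-cong (m≥n⇒m⊓n≡n q≤a) (m≥n⇒m⊓n≡n (<⇒≤ (≰⇒> a≰r)))) x))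
  ...     | no q≰a  = inj₁ (a , below (≰⇒> a≰r) (≰⇒> q≰a)
                        (subst IsP (pos-cong (m≤n⇒m⊓n≡m (<⇒≤ (≰⇒> q≰a))) (m≥n⇒m⊓n≡n (<⇒≤ (≰⇒> a≰r)))) x))

  q<q+ : ∀ i → q < suc q + i
  q<q+ i = m≤m+n (suc q) i

  exists : ∃[ p ] IsF q r r≤q p
  exists with search (suc (q + r)) (λ _ _ → ∃[ p ] IsF q r r≤q p)
                     (λ i _ → ∃[ k ] Option (suc q + i) (<⇒≤ (q<q+ i)) k)
                     (λ i _ → value-or-option (suc q + i) (q<q+ i))
  ... | inj₁ (_ , _ , v) = v
  ... | inj₂ opt
    with pigeonhole (n<1+n (q + r)) (λ i → proj₁ (opt (toℕ i) (Finₚ.toℕ<n i)))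
  ... | i , j , i<j , e = ⊥-elim
    (Option-< (<⇒≤ (q<q+ (toℕ i))) (<⇒≤ (q<q+ (toℕ j))) e
       (proj₂ (opt (toℕ i) (Finₚ.toℕ<n i))) (proj₂ (opt (toℕ j) (Finₚ.toℕ<n j)))
       (+-monoʳ-< (suc q) i<j))

IsF-exists : ∀ q r .(r≤q : r ≤ q) → ∃[ p ] IsF q r r≤q p
IsF-exists q r r≤q = Existence.exists q r (recompute (r ≤? q) r≤q)

f : ∀ q r → .(r ≤ q) → ℕ
f q r r≤q = proj₁ (IsF-exists q r r≤q)

f-spec : ∀ q r .(r≤q : r ≤ q) → IsF q r r≤q (f q r r≤q)
f-spec q r r≤q = proj₂ (IsF-exists q r r≤q)

f-unique : ∀ q r .(r≤q : r ≤ q) {p} → IsF q r r≤q p → f q r r≤q ≡ p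
f-unique q r r≤q = IsF-unique (f-spec q r r≤q)

D : Pred ℕ 0ℓ
D n = ∃[ a ] f a a ≤-refl ≡ n

S : Pred ℕ 0ℓ
S p = 1 ≤ p × ∃[ r ] Σ[ r<p ∈ r < p ] f p r (<⇒≤ r<p) ≡ p

{-# OPTIONS --safe #-}

-- A P-option of [n,n,n] has the form [n,a,a] or [n,n,r], so n lies in D or S.
--
-- Suppose that [n,n,r] and [n,a,a] are both P-positions; then r < a, as
-- otherwise the first has the second as an option. Call a row length y served
-- if some [n,y,s] with s ≤ r is a P-position. Then n is served and a is not.
-- Let z be the largest unserved length below n, so that every y with z < y ≤ n
-- is served by some s. Now [n,z,s] is an N-position whose P-option is neither
-- an option of [n,y,s] nor some [n,z,t] with t < s, hence it is [p,z,s] with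
-- z < p < n. Different y have different s, and these have different p: the
-- n - z values of y inject into the n - z - 1 values of p.
module Submission where

open import Data.Nat using (ℕ; suc; _+_; _≤_; _<_; s≤s⁻¹; _≤?_)
open import Data.Nat.Properties
open import Data.Fin using (Fin; toℕ; fromℕ<)
open import Data.Fin.Properties using (pigeonhole; toℕ<n; toℕ-fromℕ<)
open import Data.Product using (∃-syntax; _×_; _,_; proj₁; proj₂)
open import Data.Sum using (_⊎_; inj₁; inj₂)
open import Data.Empty using (⊥; ⊥-elim)
open import Relation.Nullary using (¬_; Dec; yes; no)
open import Relation.Binary.Definitions using (tri<; tri≈; tri>)
open import Relation.Binary.PropositionalEquality using (_≡_; refl; sym; trans; subst)
open import Relation.Unary using (Pred; Decidable; _∈_; _∉_)
open import Level using (0ℓ)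
open import Defs

-- Carrying the bounds as data gives a predicate on bare numbers, which can be searched over without
-- proofs in the indices.
data PPos (p q r : ℕ) : Set where
  isP : (q≤p : q ≤ p) (r≤q : r ≤ q) → IsP (pos p q r q≤p r≤q) → PPos p q r

PPos? : ∀ p q r → Dec (PPos p q r)
PPos? p q r with q ≤? p | r ≤? q
... | no q≰p  | _       = no λ { (isP q≤p _ _) → q≰p q≤p }
... | yes _   | no r≰q  = no λ { (isP _ r≤q _) → r≰q r≤q }
... | yes q≤p | yes r≤q with IsP? (pos p q r q≤p r≤q)
...   | yes x = yes (isP q≤p r≤q x)
...   | no ¬x = no λ { (isP _ _ x) → ¬x x }

∈D⇒PPos : ∀ {n} → n ∈ D → ∃[ a ] a < n × PPos n a a
∈D⇒PPos (a , refl) with f-spec a a ≤-refl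
... | below a<n n<a _   = ⊥-elim (<-asym a<n n<a)
... | above a<n a≤n x = a , a<n , isP a≤n ≤-refl x

PPos⇒∈D : ∀ {n a} → a < n → PPos n a a → n ∈ D
PPos⇒∈D {a = a} a<n (isP a≤n _ x) = a , f-unique a a ≤-refl (above a<n a≤n x)

∈S⇒PPos : ∀ {n} → n ∈ S → ∃[ r ] PPos n n r
∈S⇒PPos {n} (_ , r , r<n , e) with subst (IsF n r (<⇒≤ r<n)) e (f-spec n r (<⇒≤ r<n))
... | below _ n<n _   = ⊥-elim (<-irrefl refl n<n)
... | above _ n≤n x = r , isP n≤n (<⇒≤ r<n) x

PPos⇒∈S : ∀ {n r} → 1 ≤ n → r < n → PPos n n r → n ∈ S
PPos⇒∈S {n} {r} 1≤n r<n (isP n≤n _ x) =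
  1≤n , r , r<n , f-unique n r (<⇒≤ r<n) (above r<n n≤n x)

D∪S : ∀ n → 1 ≤ n → n ∈ D ⊎ n ∈ S
D∪S (suc m) 1≤n with P⊎N (pos (suc m) (suc m) (suc m) ≤-refl ≤-refl)
... | inj₁ x = ⊥-elim (¬P-equal (suc m) x)
-- Cutting row 1 leaves three equal rows, which never form a P-position.
... | inj₂ (someP (cut₁ a a<n) x) =
  ⊥-elim (¬P-equal a {≤-refl} {≤-refl}
    (subst IsP (pos-cong (m≤n⇒m⊓n≡m (<⇒≤ a<n)) (m≤n⇒m⊓n≡m (<⇒≤ a<n))) x))
... | inj₂ (someP (cut₂ a a<n) x) =
  inj₁ (PPos⇒∈D a<n (isP (<⇒≤ a<n) ≤-refl (subst IsP (pos-cong refl (m≤n⇒m⊓n≡m (<⇒≤ a<n))) x)))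
... | inj₂ (someP (cut₃ b b<n) x) = inj₂ (PPos⇒∈S 1≤n b<n (isP ≤-refl (<⇒≤ b<n) x))

PPos-row₂-≮ : ∀ {p q q′ r} → PPos p q r → PPos p q′ r → ¬ q < q′
PPos-row₂-≮ (isP _ r≤q x) (isP _ _ y) q<q′ =
  P⟶P⇒⊥ y (cut₂-to _ q<q′ (m≥n⇒m⊓n≡n r≤q)) x

PPos-row₃-≮ : ∀ {p q r r′} → PPos p q r → PPos p q r′ → ¬ r < r′
PPos-row₃-≮ (isP _ _ x) (isP _ _ y) r<r′ = P⟶P⇒⊥ y (cut₃ _ r<r′) x

PPos-row₃-≡ : ∀ {p q r r′} → PPos p q r → PPos p q r′ → r ≡ r′
PPos-row₃-≡ {r = r} {r′} x y with <-cmp r r′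
... | tri< r<r′ _ _ = ⊥-elim (PPos-row₃-≮ x y r<r′)
... | tri≈ _ e _    = e
... | tri> _ _ r′<r = ⊥-elim (PPos-row₃-≮ y x r′<r)

-- A cut of row 2 below `z`, or of row 1 to at most `z`, erases the difference between `y` and `z`,
-- so such a reply would also be an option of `[n,y,s]`.
reply-in-row₁ : ∀ {n y z s} → PPos n y s → z < y → s ≤ z → (∀ {t} → t < s → ¬ PPos n z t) →
                ∃[ p ] z < p × p < n × PPos p z s
reply-in-row₁ {n} {y} {z} {s} (isP y≤n s≤y x) z<y s≤z ¬row₃
  with P⊎N (pos n z s (≤-trans (<⇒≤ z<y) y≤n) s≤z)
... | inj₁ w = ⊥-elim (P⟶P⇒⊥ x (cut₂-to z z<y (m≥n⇒m⊓n≡n s≤z)) w)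
... | inj₂ atOrigin = ⊥-elim (n≮0 (<-≤-trans z<y y≤n))
... | inj₂ (someP (cut₂ b b<z) w) = ⊥-elim (P⟶P⇒⊥ x (cut₂ b (<-trans b<z z<y)) w)
... | inj₂ (someP (cut₃ t t<s) w) =
  ⊥-elim (¬row₃ t<s (isP (≤-trans (<⇒≤ z<y) y≤n) (≤-trans (<⇒≤ t<s) s≤z) w))
... | inj₂ (someP (cut₁ p p<n) w) with p ≤? z
...   | yes p≤z = ⊥-elim (P⟶P⇒⊥ x
          (cut₁-to p p<n (trans (m≤n⇒m⊓n≡m (≤-trans p≤z (<⇒≤ z<y))) (sym (m≤n⇒m⊓n≡m p≤z))) refl) w)
...   | no p≰z  = p , z<p , p<n , isP (<⇒≤ z<p) s≤z
          (subst IsP (pos-cong (m≥n⇒m⊓n≡n (<⇒≤ z<p)) (m≥n⇒m⊓n≡n (≤-trans s≤z (<⇒≤ z<p)))) w)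
  where
  z<p = ≰⇒> p≰z

largest-counterexample : ∀ {Q : Pred ℕ 0ℓ} → Decidable Q → ∀ {a} n → a < n → ¬ Q a →
                         ∃[ z ] a ≤ z × z < n × ¬ Q z × (∀ y → z < y → y < n → Q y)
largest-counterexample Q? (suc n) a<1+n ¬Qa with Q? n
... | no ¬Qn = n , s≤s⁻¹ a<1+n , n<1+n n , ¬Qn , λ y n<y y<1+n → ⊥-elim (<⇒≱ n<y (s≤s⁻¹ y<1+n))
... | yes Qn with m≤n⇒m<n∨m≡n (s≤s⁻¹ a<1+n)
...   | inj₂ refl = ⊥-elim (¬Qa Qn)
...   | inj₁ a<n with largest-counterexample Q? n a<n ¬Qa
...     | z , a≤z , z<n , ¬Qz , above-z = z , a≤z , m<n⇒m<1+n z<n , ¬Qz , above-z′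
  where
  above-z′ : ∀ y → z < y → y < suc n → _
  above-z′ y z<y y<1+n with m≤n⇒m<n∨m≡n (s≤s⁻¹ y<1+n)
  ... | inj₁ y<n  = above-z y z<y y<n
  ... | inj₂ refl = Qn

-- The bound `s ≤ r` is written `s < suc r` to fit `anyUpTo?`.
Served : ℕ → ℕ → Pred ℕ 0ℓ
Served n r y = ∃[ s ] s < suc r × PPos n y s

Served? : ∀ n r → Decidable (Served n r)
Served? n r y = anyUpTo? (PPos? n y) (suc r)

-- The pigeonhole indexes y by z + 1 + i with i ≤ k, and p by z + 1 + o with o < k.
served-above⇒served : ∀ z k r → r ≤ z → (∀ y → z < y → y ≤ suc z + k → Served (suc z + k) r y) →
                      ¬ ¬ Served (suc z + k) r z
served-above⇒served z k r r≤z served ¬served = contradictory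
  where
  n = suc z + k

  Reply : ℕ → ℕ → Set
  Reply i o = ∃[ s ] PPos n (suc z + i) s × PPos (suc z + o) z s

  reply : (i : Fin (suc k)) → ∃[ j ] Reply (toℕ i) (toℕ {k} j)
  reply i with served (suc z + toℕ i) (m≤m+n (suc z) (toℕ i))
                      (+-monoʳ-≤ (suc z) (s≤s⁻¹ (toℕ<n i)))
  ... | s , s<1+r , x
    with reply-in-row₁ x (m≤m+n (suc z) (toℕ i)) (≤-trans (s≤s⁻¹ s<1+r) r≤z)
           -- A P-position `[n,z,t]` with `t < s ≤ r` would make `z` served.
           (λ t<s w → ¬served (_ , <-trans t<s s<1+r , w))
  ... | p , z<p , p<n , w with m≤n⇒∃[o]m+o≡n z<p
  ... | o , refl = fromℕ< o<k , subst (Reply (toℕ i)) (sym (toℕ-fromℕ< o<k)) (s , x , w)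
    where
    o<k : o < k
    o<k = +-cancelˡ-< (suc z) o k p<n

  -- A common `o` forces a common `s`; then the longer row 2 could be cut to the shorter, so that
  -- one P-position leads to another.
  Reply-< : ∀ {i j o} → Reply i o → Reply j o → ¬ i < j
  Reply-< (_ , x , w) (_ , y , v) i<j with PPos-row₃-≡ w v
  ... | refl = PPos-row₂-≮ x y (+-monoʳ-< (suc z) i<j)

  contradictory : ⊥
  contradictory with pigeonhole (n<1+n k) (λ i → proj₁ (reply i))
  ... | i , j , i<j , e =
    Reply-< (subst (λ o → Reply (toℕ i) (toℕ o)) e (proj₂ (reply i))) (proj₂ (reply j)) i<j

PPos-exclusive : ∀ {n a r} → a < n → PPos n a a → ¬ PPos n n r
PPos-exclusive {n} {a} {r} a<n x@(isP _ _ x′) y@(isP _ _ y′) with a ≤? r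
... | yes a≤r = P⟶P⇒⊥ y′ (cut₂-to a a<n (m≤n⇒m⊓n≡m a≤r)) x′
... | no a≰r
  with largest-counterexample (Served? n r) n a<n
         -- The length `a` is not served: with `s ≤ r < a`, `[n,a,s]` is an option of `[n,a,a]`.
         (λ { (s , s<1+r , w) → PPos-row₃-≮ w x (≤-<-trans (s≤s⁻¹ s<1+r) (≰⇒> a≰r)) })
... | z , a≤z , z<n , ¬served , served with m≤n⇒∃[o]m+o≡n z<n
... | k , refl = served-above⇒served z k r (≤-trans (<⇒≤ (≰⇒> a≰r)) a≤z) served′ ¬served
  where
  served′ : ∀ y → z < y → y ≤ suc z + k → Served (suc z + k) r y
  served′ w z<w w≤n with m≤n⇒m<n∨m≡n w≤n
  ... | inj₁ w<n  = served w z<w w<n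
  -- The search covers only lengths below `n`; `n` itself is served by `[n,n,r]`.
  ... | inj₂ refl = r , n<1+n r , y

D∩S : ∀ {n} → n ∈ D → n ∉ S
D∩S d s with ∈D⇒PPos d | ∈S⇒PPos s
... | _ , a<n , x | _ , y = PPos-exclusive a<n x y

proposition4p4 : (n : ℕ) → 1 ≤ n → (n ∈ D × n ∉ S) ⊎ (n ∉ D × n ∈ S)
proposition4p4 n 1≤n with D∪S n 1≤n
... | inj₁ d = inj₁ (d , D∩S d)
... | inj₂ s = inj₂ ((λ d → D∩S d s) , s)
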